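{- Let $r\ge 1$ and let $\tau$ be a bijection from $F^r$ to $F^r$ such that $\tau({\bf 0})={\bf 0}$ and the deficiency of $\tau$ is $r$. Then the code $S_{\mathcal H,\tau}=\bigcup_{a\in F^r}\mathcal H_a\times\mathcal H_{\tau(a)}$ is not equivalent to any extended perfect Mollard code, and the code $S'_{\mathcal H,\tau}=\bigcup_{a\in F^r}\mathcal H'_a\times\mathcal H_{\tau(a)}$ is not equivalent to any perfect Mollard code.
   Context: $F=\mathrm{GF}(2)$; a code of length $n$ is a set of vectors of $F^n$. $\mathrm{wt}$ is Hamming weight. ${\bf 0}$ denotes the all-zero vector. A code $C\subseteq F^n$ is perfect if for every $x\in F^n$ there is exactly one $y\in C$ at Hamming distance at most $1$ from $x$. Extending a code means adding an overall parity check coordinate to all its codewords. Two codes of length $n$ are equivalent if some transformation $y\mapsto x+\pi(y)$, with $x\in F^n$ and $\pi$ a permutation of the coordinate positions, maps one onto the other. The coordinates of $F^{2^r}$ are indexed by the vectors of $F^r$, and those of $F^{2^r-1}$ by the nonzero vectors of $F^r$; $e_a$ is the vector (in either space) whose only nonzero coordinate is the one indexed by $a$. $\mathcal H=\{c\in F^{2^r}:\sum_{a:c_a=1}a={\bf 0},\ \mathrm{wt}(c)\equiv 0 \pmod 2\}$, $\mathcal H_a=\mathcal H+e_a+e_{\bf 0}$ for $a\in F^r$; $\mathcal H'=\{c\in F^{2^r-1}:\sum_{a:c_a=1}a={\bf 0}\}$, $\mathcal H'_a=e_a+\mathcal H'$ for $a\neq{\bf 0}$, $\mathcal H'_{\bf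 0}=\mathcal H'$. For codes $C,D$, $C\times D=\{x|y: x\in C,\ y\in D\}$, where $x|y$ is concatenation. For nonzero $a\in F^r$, $\mathrm{Star}(a)=\{\{a,b,a+b\}: b\in F^r\setminus\{{\bf 0},a\}\}$, and $\tau(\mathrm{Star}(a))=\{\{\tau(a),\tau(b),\tau(a+b)\}: b\in F^r\setminus\{{\bf 0},a\}\}$. The number of nonzero $a$ with $\tau(\mathrm{Star}(a))=\mathrm{Star}(\tau(a))$ is always a power of two minus one, and the deficiency of $\tau$ is $r-\log_2\left(|\{a\in F^r\setminus\{{\bf 0}\}:\tau(\mathrm{Star}(a))=\mathrm{Star}(\tau(a))\}|+1\right)$. Mollard codes: let $C$ and $D$ be perfect codes of lengths $t$ and $m$ respectively, both containing the all-zero vector, and let $f:C\to F^m$ be any function. Index the coordinates of $F^{tm}$ by pairs $(i,j)$, $1\le i\le t$, $1\le j\le m$. Define $p_1:F^{tm}\to F^t$ and $p_2:F^{tm}\to F^m$ by $(p_1(x))_i=\sum_{j=1}^m x_{(i,j)}$, $(p_2(x))_j=\sum_{i=1}^t x_{(i,j)}$. Let $Z=\{(x|p_1(x)|p_2(x)):x\in F^{tm}\}$. The (perfect) Mollard code of length $tm+t+m$ is $M(C,D)=\{({\bf 0}|y|z+f(y)): y\in C,\ z\in D\}+Z$. An extended perfect Mollard code is the extension of such a code by an overall parity check. -}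

module Defs where

open import Algebra.Bundles using (RawMonoid)
import Algebra.Definitions.RawMonoid as Summation
open import Data.Bool.Base using (Bool; true; false; _xor_; if_then_else_)
import Data.Bool.Properties as Bool
open import Data.Fin.Base using (Fin; zero; suc; cast; combine)
open import Data.Fin.Permutation using (Permutation; _⟨$⟩ˡ_)
open import Data.Fin.Properties using (2↔Bool; *↔×)
open import Data.Fin.Subset using (Subset; _∪_)
open import Data.Fin.Subset.Properties using (anySubset?)
open import Data.Nat.Base using (ℕ; zero; suc; _+_; _*_; _∸_; _^_; _≤_; NonZero)
open import Data.Nat.DivMod using (_%_)
open import Data.Nat.Logarithm using (⌊log₂_⌋)
open import Data.Nat.Properties using (suc-pred; m^n≢0)
open import Data.Product using (∃; ∃₂; ∃!; _×_; _,_; uncurry)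
open import Data.Product.Function.NonDependent.Propositional using (_×-↔_)
open import Data.Vec.Base
  using (Vec; []; _∷_; _++_; _∷ʳ_; count; lookup; replicate; tabulate; uncons; zipWith)
open import Data.Vec.Properties using (≡-dec)
open import Function.Bundles using (_↔_; mk↔ₛ′; Inverse)
open import Function.Construct.Composition using (_↔-∘_)
open import Level using (Level; 0ℓ)
open import Relation.Binary.Definitions using (DecidableEquality)
open import Relation.Binary.PropositionalEquality.Core using (_≡_; _≢_; refl)
open import Relation.Nullary.Decidable
  using (Dec; does; map′; ¬?; _×-dec_; _→-dec_; decidable-stable)
open import Relation.Unary using (Pred; Decidable; _∈_; _≐_; ⋃)

-- GF(2) is Bool with _xor_ as addition.

F : ℕ → Set
F n = Vec Bool n

infixl 6 _⊕_

_⊕_ : ∀ {n} → F n → F n → F n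
_⊕_ = zipWith _xor_

𝟎 : ∀ {n} → F n
𝟎 = replicate _ false

infix 4 _≟_

_≟_ : ∀ {n} → DecidableEquality (F n)
_≟_ = ≡-dec Bool._≟_

Bool-+-rawMonoid : RawMonoid 0ℓ 0ℓ
Bool-+-rawMonoid = record { Carrier = Bool ; _≈_ = _≡_ ; _∙_ = _xor_ ; ε = false }

F-+-rawMonoid : ℕ → RawMonoid 0ℓ 0ℓ
F-+-rawMonoid n = record { Carrier = F n ; _≈_ = _≡_ ; _∙_ = _⊕_ ; ε = 𝟎 }

sumᵇ : ∀ {n} → (Fin n → Bool) → Bool
sumᵇ = Summation.sum Bool-+-rawMonoid

sumᵛ : ∀ {r n} → (Fin n → F r) → F r
sumᵛ {r} = Summation.sum (F-+-rawMonoid r)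

wt : ∀ {n} → F n → ℕ
wt = count (Bool._≟ true)

distance : ∀ {n} → F n → F n → ℕ
distance x y = wt (x ⊕ y)

Code : ℕ → Set₁
Code n = Pred (F n) 0ℓ

image : ∀ {m n} → (F m → F n) → Code m → Code n
image g C w = ∃ λ c → c ∈ C × w ≡ g c

infixr 7 _×ᶜ_

_×ᶜ_ : ∀ {m n} → Code m → Code n → Code (m + n)
(C ×ᶜ D) w = ∃₂ λ x y → x ∈ C × y ∈ D × w ≡ x ++ y

Perfect : ∀ {n} → Code n → Set
Perfect C = ∀ x → ∃! _≡_ λ y → y ∈ C × distance x y ≤ 1

extend : ∀ {n} → Code n → Code (suc n)
extend = image λ c → c ∷ʳ sumᵇ (lookup c)

permute : ∀ {m n} → Permutation m n → F m → F n
permute π y = tabulate λ i → lookup y (π ⟨$⟩ˡ i)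

-- A bijection Fin m ↔ Fin n forces m ≡ n; allowing two names for the common
-- length avoids transporting codes between, e.g., 2 ^ r + 2 ^ r and
-- suc (t * m + (t + m)).
Equivalent : ∀ {m n} → Code m → Code n → Set
Equivalent {m} {n} C D =
  ∃₂ λ (x : F n) (π : Permutation m n) → image (λ y → x ⊕ permute π y) C ≐ D

point↔ : ∀ r → Fin (2 ^ r) ↔ F r
point↔ zero = mk↔ₛ′ (λ _ → []) (λ _ → zero) (λ { [] → refl }) (λ { zero → refl })
point↔ (suc r) = ∷↔ ↔-∘ ((2↔Bool ×-↔ point↔ r) ↔-∘ *↔×)
  where
  ∷↔ : (Bool × F r) ↔ F (suc r)
  ∷↔ = mk↔ₛ′ (uncurry _∷_) uncons (λ { (_ ∷ _) → refl }) (λ _ → refl)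

point : ∀ {r} → Fin (2 ^ r) → F r
point {r} = Inverse.to (point↔ r)

-- The first position of F (2 ^ r) is the one indexed by 𝟎, so dropping it
-- leaves the positions indexed by the nonzero vectors.
1+[2^r∸1]≡2^r : ∀ r → suc (2 ^ r ∸ 1) ≡ 2 ^ r
1+[2^r∸1]≡2^r r = suc-pred (2 ^ r) {{m^n≢0 2 r}}

point′ : ∀ {r} → Fin (2 ^ r ∸ 1) → F r
point′ {r} i = point (cast (1+[2^r∸1]≡2^r r) (suc i))

e : ∀ {r} → F r → F (2 ^ r)
e a = tabulate λ i → does (point i ≟ a)

-- No position is indexed by 𝟎 here, so e′ 𝟎 is the zero word.
e′ : ∀ {r} → F r → F (2 ^ r ∸ 1)
e′ a = tabulate λ i → does (point′ i ≟ a)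

𝓗 : ∀ r → Code (2 ^ r)
𝓗 r c = sumᵛ (λ i → if lookup c i then point i else 𝟎) ≡ 𝟎 {r} × wt c % 2 ≡ 0

𝓗[_] : ∀ {r} → F r → Code (2 ^ r)
𝓗[_] {r} a = image (λ h → h ⊕ e a ⊕ e {r} 𝟎) (𝓗 r)

𝓗′ : ∀ r → Code (2 ^ r ∸ 1)
𝓗′ r c = sumᵛ (λ i → if lookup c i then point′ i else 𝟎) ≡ 𝟎 {r}

-- Since e′ 𝟎 ≡ 𝟎, this gives 𝓗′ itself for a = 𝟎.
𝓗′[_] : ∀ {r} → F r → Code (2 ^ r ∸ 1)
𝓗′[_] {r} a = image (λ h → e′ a ⊕ h) (𝓗′ r)

S : ∀ {r} → (F r → F r) → Code (2 ^ r + 2 ^ r)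
S {r} τ = ⋃[ a ∶ F r ] (𝓗[ a ] ×ᶜ 𝓗[ τ a ])

S′ : ∀ {r} → (F r → F r) → Code ((2 ^ r ∸ 1) + 2 ^ r)
S′ {r} τ = ⋃[ a ∶ F r ] (𝓗′[ a ] ×ᶜ 𝓗[ τ a ])

-- A set of vectors of F r is given by its characteristic vector, indexed by
-- point; e a is then the singleton {a}.
triple : ∀ {r} → F r → F r → F r → Subset (2 ^ r)
triple a b c = e a ∪ e b ∪ e c

Star : ∀ {r} → F r → Pred (Subset (2 ^ r)) 0ℓ
Star a T = ∃ λ b → b ≢ 𝟎 × b ≢ a × T ≡ triple a b (a ⊕ b)

τ[Star_] : ∀ {r} → F r → (F r → F r) → Pred (Subset (2 ^ r)) 0ℓ
τ[Star a ] τ T = ∃ λ b → b ≢ 𝟎 × b ≢ a × T ≡ triple (τ a) (τ b) (τ (a ⊕ b))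

PreservesStar : ∀ {r} → (F r → F r) → Pred (F r) 0ℓ
PreservesStar τ a = τ[Star a ] τ ≐ Star (τ a)

allVec? : ∀ {n} {ℓ : Level} {P : Pred (F n) ℓ} → Decidable P → Dec (∀ {x} → P x)
allVec? P? = map′
  (λ ¬∃¬ {x} → decidable-stable (P? x) λ ¬p → ¬∃¬ (x , ¬p))
  (λ { ∀p (x , ¬p) → ¬p ∀p })
  (¬? (anySubset? λ x → ¬? (P? x)))

PreservesStar? : ∀ {r} (τ : F r → F r) → Decidable (PreservesStar τ)
PreservesStar? τ a =
  allVec? (λ T → image? T →-dec star? T) ×-dec allVec? (λ T → star? T →-dec image? T)
  where
  image? : Decidable (τ[Star a ] τ)
  image? T = anySubset? λ b →
    ¬? (b ≟ 𝟎) ×-dec ¬? (b ≟ a) ×-dec T ≟ triple (τ a) (τ b) (τ (a ⊕ b))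

  star? : Decidable (Star (τ a))
  star? T = anySubset? λ b →
    ¬? (b ≟ 𝟎) ×-dec ¬? (b ≟ τ a) ×-dec T ≟ triple (τ a) b (τ a ⊕ b)

preservedStars : ∀ {r} → (F r → F r) → ℕ
preservedStars {r} τ =
  count (λ a → ¬? (a ≟ 𝟎) ×-dec PreservesStar? τ a) (tabulate (point {r}))

-- For bijective τ fixing 𝟎, preservedStars τ + 1 is a power of two that is at
-- most 2 ^ r, so neither the rounding nor the truncation loses anything.
deficiency : ∀ {r} → (F r → F r) → ℕ
deficiency {r} τ = r ∸ ⌊log₂ preservedStars τ + 1 ⌋

module _ {t m : ℕ} where

  p₁ : F (t * m) → F t
  p₁ x = tabulate λ i → sumᵇ λ j → lookup x (combine i j)

  p₂ : F (t * m) → F m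
  p₂ x = tabulate λ j → sumᵇ λ i → lookup x (combine {t} i j)

-- Lengths are positive: t = 0 would make every perfect code containing 𝟎 a
-- Mollard code. The irrelevant argument makes f a function on the elements
-- of C, independent of the proof of membership.
record Mollard : Set₁ where
  field
    {t m} : ℕ
    {{t≢0}} : NonZero t
    {{m≢0}} : NonZero m
    C : Code t
    D : Code m
    C-perfect : Perfect C
    D-perfect : Perfect D
    𝟎∈C : 𝟎 ∈ C
    𝟎∈D : 𝟎 ∈ D
    f : (y : F t) → .(y ∈ C) → F m

  code : Code (t * m + (t + m))
  code w = ∃ λ x → ∃ λ y → ∃ λ z → ∃ λ (y∈C : y ∈ C) → z ∈ D ×
    w ≡ (𝟎 {t * m} ++ y ++ (z ⊕ f y y∈C)) ⊕ (x ++ p₁ x ++ p₂ {t} x)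

{-# OPTIONS --safe #-}
module Submission where

-- Let k be the word supported on the coordinates (i, j), (i, 0), (0, j) of a
-- Mollard code, together with the parity coordinate in the extended case.
-- Adding k preserves the code, so a coordinate permutation of k is a period of
-- the equivalent code S or S′. A period with syndromes s and s₂ on the two
-- halves satisfies τ (a + s) = τ a + τ s for all a and s₂ = τ s; deficiency r
-- forces s = 𝟎, so on the right half a period has even weight and syndrome 𝟎.
-- As k has weight at most four, it cannot meet the right half in exactly two
-- positions, since these would carry equal points. Hence each such k lies in
-- one half: in the left one for S′, where the weight is three, and for S in
-- the half containing the parity coordinate, which all these words share. But
-- the words k cover all coordinates, and both halves are nonempty.

open import Defs
open import Algebra.Bundles using (AbelianGroup; CommutativeRing)
import Algebra.Properties.CommutativeMonoid.Sum as CommutativeMonoidSum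
import Algebra.Properties.Group as GroupProperties
open import Data.Bool.Base using (Bool; true; false; _xor_; if_then_else_)
import Data.Bool.Properties as Bool
open import Data.Empty using (⊥-elim)
open import Data.Fin.Base
  using (Fin; zero; suc; cast; combine; fromℕ; inject₁; splitAt; toℕ; _↑ˡ_; _↑ʳ_)
open import Data.Fin.Permutation
  using (Permutation; _⟨$⟩ʳ_; _⟨$⟩ˡ_; flip; inverseˡ; inverseʳ)
import Data.Fin.Properties as Fin
open import Data.Fin.Relation.Unary.Top using (view; ‵fromℕ; ‵inj₁)
open import Data.Fin.Subset using (⁅_⁆)
open import Data.List.Base using (List; []; _∷_; catMaybes; foldr; map)
open import Data.List.Relation.Unary.Any using (here; there)
open import Data.List.Relation.Unary.All as All using (All; []; _∷_)
import Data.List.Relation.Unary.All.Properties as All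
open import Data.List.Relation.Unary.AllPairs as AllPairs using (AllPairs; []; _∷_)
import Data.List.Relation.Unary.AllPairs.Properties as AllPairs
open import Data.List.Relation.Unary.Unique.Propositional using (Unique)
import Data.List.Relation.Unary.Unique.Propositional.Properties as Unique
open import Data.Maybe.Base using (Maybe; just; nothing; is-just)
open import Data.Maybe.Properties using (just-injective)
open import Data.Nat.Base using (ℕ; zero; suc; _+_; _*_; _∸_; _^_; _≤_; s≤s; NonZero)
open import Data.Nat.DivMod using (_%_)
open import Data.Nat.Logarithm using (⌊log₂_⌋; ⌊log₂⌋-mono-≤; ⌊log₂[2^n]⌋≡n)
import Data.Nat.Properties as ℕ
open import Data.Product.Base using (_×_; _,_; ∃; proj₁; proj₂)
open import Data.Sum.Base using (_⊎_; inj₁; inj₂; [_,_]′)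
open import Data.Vec.Base using (Vec; []; _∷_; _++_; _∷ʳ_; count; head; lookup; tabulate)
import Data.Vec.Properties as Vec
open import Function.Base using (_∘_; const; id)
open import Function.Bundles using (Inverse)
open import Function.Definitions using (Bijective; Injective)
open import Level using (0ℓ)
open import Relation.Binary.PropositionalEquality
open import Relation.Nullary.Decidable
  using (does; yes; no; does-≡; map′; ¬?; _×-dec_)
open import Relation.Nullary.Negation.Core using (¬_; contradiction)
open import Relation.Unary using (Pred; Decidable; _∈_; ⋃)

-- Vectors over GF(2) and syndromes

⊕-abelianGroup : ℕ → AbelianGroup 0ℓ 0ℓ
⊕-abelianGroup d = record
  { Carrier = F d ; _≈_ = _≡_ ; _∙_ = _⊕_ ; ε = 𝟎 ; _⁻¹ = id
  ; isAbelianGroup = record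
    { isGroup = record
      { isMonoid = record
        { isSemigroup = record
          { isMagma = record { isEquivalence = isEquivalence ; ∙-cong = cong₂ _⊕_ }
          ; assoc = Vec.zipWith-assoc Bool.xor-assoc }
        ; identity = Vec.zipWith-identityˡ Bool.xor-identityˡ
                   , Vec.zipWith-identityʳ Bool.xor-identityʳ }
      ; inverse = ⊕-same , ⊕-same
      ; ⁻¹-cong = id }
    ; comm = Vec.zipWith-comm Bool.xor-comm } }
  where
  ⊕-same : (v : F d) → v ⊕ v ≡ 𝟎
  ⊕-same v = trans (cong (_⊕ v) (sym (Vec.map-id v))) (Vec.zipWith-inverseˡ Bool.xor-same v)

module ⊕ {d : ℕ} where
  open AbelianGroup (⊕-abelianGroup d) public
    using (assoc; comm; identityˡ; identityʳ; group; commutativeMonoid)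
  open GroupProperties group public using (∙-cancelˡ; x∙y⁻¹≈ε⇒x≈y)
  open CommutativeMonoidSum commutativeMonoid public

module xor =
  CommutativeMonoidSum (CommutativeRing.+-commutativeMonoid Bool.xor-∧-commutativeRing)

-- The labelling `σ` is arbitrary, so the same linear map serves for the Hamming checks, for parity
-- and for either half of a concatenated word.
syndrome : ∀ {n d} → (Fin n → F d) → F n → F d
syndrome σ c = sumᵛ λ i → if lookup c i then σ i else 𝟎

module _ {d : ℕ} where

  if-xor-⊕ : ∀ b b′ (v : F d) →
    (if b xor b′ then v else 𝟎) ≡ (if b then v else 𝟎) ⊕ (if b′ then v else 𝟎)
  if-xor-⊕ false b′    v = sym (⊕.identityˡ _)
  if-xor-⊕ true  false v = sym (⊕.identityʳ v)
  if-xor-⊕ true  true  v = sym (AbelianGroup.inverseˡ (⊕-abelianGroup d) v)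

  syndrome-cong : ∀ {n} {σ σ′ : Fin n → F d} → σ ≗ σ′ → syndrome σ ≗ syndrome σ′
  syndrome-cong σ≗σ′ c =
    ⊕.sum-cong-≗ λ i → cong (λ v → if lookup c i then v else 𝟎) (σ≗σ′ i)

  syndrome-⊕ : ∀ {n} (σ : Fin n → F d) c c′ →
    syndrome σ (c ⊕ c′) ≡ syndrome σ c ⊕ syndrome σ c′
  syndrome-⊕ σ c c′ = trans
    (⊕.sum-cong-≗ λ i → trans
      (cong (λ b → if b then σ i else 𝟎) (Vec.lookup-zipWith _xor_ i c c′))
      (if-xor-⊕ (lookup c i) (lookup c′ i) (σ i)))
    (⊕.∑-distrib-+ (λ i → if lookup c i then σ i else 𝟎) λ i → if lookup c′ i then σ i else 𝟎)

  syndrome-++ : ∀ {m n} (σ : Fin (m + n) → F d) (x : F m) (y : F n) →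
    syndrome σ (x ++ y) ≡ syndrome (σ ∘ (_↑ˡ n)) x ⊕ syndrome (σ ∘ (m ↑ʳ_)) y
  syndrome-++ σ []      y = sym (⊕.identityˡ _)
  syndrome-++ σ (b ∷ x) y =
    trans (cong ((if b then σ zero else 𝟎) ⊕_) (syndrome-++ (σ ∘ suc) x y))
          (sym (⊕.assoc (if b then σ zero else 𝟎) _ _))

  syndrome-∷ʳ : ∀ {n} (σ : Fin (suc n) → F d) (x : F n) b →
    syndrome σ (x ∷ʳ b) ≡ syndrome (σ ∘ inject₁) x ⊕ (if b then σ (fromℕ n) else 𝟎)
  syndrome-∷ʳ σ []      b = ⊕.comm (if b then σ zero else 𝟎) 𝟎
  syndrome-∷ʳ σ (a ∷ x) b =
    trans (cong ((if a then σ zero else 𝟎) ⊕_) (syndrome-∷ʳ (σ ∘ suc) x b))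
          (sym (⊕.assoc (if a then σ zero else 𝟎) _ _))

  syndrome-𝟎 : ∀ {n} (σ : Fin n → F d) → syndrome σ 𝟎 ≡ 𝟎
  syndrome-𝟎 {zero}  σ = refl
  syndrome-𝟎 {suc n} σ = trans (⊕.identityˡ _) (syndrome-𝟎 (σ ∘ suc))

  syndrome-const𝟎 : ∀ {n} (c : F n) → syndrome (const (𝟎 {d})) c ≡ 𝟎
  syndrome-const𝟎 []          = refl
  syndrome-const𝟎 (false ∷ c) = trans (⊕.identityˡ _) (syndrome-const𝟎 c)
  syndrome-const𝟎 (true  ∷ c) = trans (⊕.identityˡ _) (syndrome-const𝟎 c)

  syndrome-⁅⁆ : ∀ {n} (σ : Fin n → F d) p → syndrome σ ⁅ p ⁆ ≡ σ p
  syndrome-⁅⁆ σ zero    = trans (cong (σ zero ⊕_) (syndrome-𝟎 (σ ∘ suc))) (⊕.identityʳ _)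
  syndrome-⁅⁆ σ (suc p) = trans (⊕.identityˡ _) (syndrome-⁅⁆ (σ ∘ suc) p)

  syndrome-permute : ∀ {m n} (σ : Fin n → F d) (π : Permutation m n) (c : F m) →
    syndrome σ (permute π c) ≡ syndrome (σ ∘ (π ⟨$⟩ʳ_)) c
  syndrome-permute σ π c = trans
    (⊕.sum-permute (λ i → if lookup (permute π c) i then σ i else 𝟎) π)
    (⊕.sum-cong-≗ λ i → cong (λ b → if b then σ (π ⟨$⟩ʳ i) else 𝟎)
      (trans (Vec.lookup∘tabulate _ (π ⟨$⟩ʳ i)) (cong (lookup c) (inverseˡ π))))

  -- A head bit `true` in every label counts the ones of the word modulo two, which makes parity and
  -- Hamming check a single syndrome.
  syndrome-true∷ : ∀ {n} (σ : Fin n → F d) c →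
    syndrome (λ i → true ∷ σ i) c ≡ sumᵇ (lookup c) ∷ syndrome σ c
  syndrome-true∷ σ []          = refl
  syndrome-true∷ σ (false ∷ c) = cong (𝟎 ⊕_) (syndrome-true∷ (σ ∘ suc) c)
  syndrome-true∷ σ (true  ∷ c) = cong ((true ∷ σ zero) ⊕_) (syndrome-true∷ (σ ∘ suc) c)

wt-even⇒sumᵇ : ∀ {n} (c : F n) → wt c % 2 ≡ 0 → sumᵇ (lookup c) ≡ false
wt-even⇒sumᵇ c = trans (sumᵇ-wt c) ∘ odd-even (wt c)
  where
  odd : ℕ → Bool
  odd zero    = false
  odd (suc n) = true xor odd n

  odd-even : ∀ n → n % 2 ≡ 0 → odd n ≡ false
  odd-even zero          _  = refl
  odd-even (suc (suc n)) eq = trans (Bool.not-involutive _) (odd-even n eq)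

  sumᵇ-wt : ∀ {n} (c : F n) → sumᵇ (lookup c) ≡ odd (wt c)
  sumᵇ-wt []          = refl
  sumᵇ-wt (false ∷ c) = sumᵇ-wt c
  sumᵇ-wt (true  ∷ c) = cong (true xor_) (sumᵇ-wt c)

wt-𝟎 : ∀ n → wt (𝟎 {n}) ≡ 0
wt-𝟎 zero    = refl
wt-𝟎 (suc n) = wt-𝟎 n

lookup-⁅⁆ : ∀ {n} (p i : Fin n) → lookup ⁅ p ⁆ i ≡ does (i Fin.≟ p)
lookup-⁅⁆ zero    zero    = refl
lookup-⁅⁆ zero    (suc i) = Vec.lookup-replicate i false
lookup-⁅⁆ (suc p) zero    = refl
lookup-⁅⁆ (suc p) (suc i) = lookup-⁅⁆ p i

sumᵇ-⁅⁆ : ∀ {n} (p : Fin n) → sumᵇ (lookup ⁅ p ⁆) ≡ true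
sumᵇ-⁅⁆ p = cong head (trans (sym (syndrome-true∷ (const []) ⁅ p ⁆))
  (syndrome-⁅⁆ (const (true ∷ [])) p))

-- Points and the syndromes of the Hamming cosets

index : ∀ {r} → F r → Fin (2 ^ r)
index {r} = Inverse.from (point↔ r)

point-index : ∀ {r} (a : F r) → point (index a) ≡ a
point-index {r} a = Inverse.inverseˡ (point↔ r) refl

point-injective : ∀ {r} → Injective _≡_ _≡_ (point {r})
point-injective {r} {i} {j} eq = trans (sym (Inverse.inverseʳ (point↔ r) refl))
  (trans (cong index eq) (Inverse.inverseʳ (point↔ r) refl))

toℕ-index-𝟎 : ∀ r → toℕ (index (𝟎 {r})) ≡ 0
toℕ-index-𝟎 zero    = refl
toℕ-index-𝟎 (suc r) = trans (Fin.toℕ-↑ˡ (index (𝟎 {r})) _) (toℕ-index-𝟎 r)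

point′-injective : ∀ {r} → Injective _≡_ _≡_ (point′ {r})
point′-injective {r} {i} {j} eq = Fin.suc-injective (Fin.toℕ-injective
  (trans (sym (Fin.toℕ-cast (1+[2^r∸1]≡2^r r) (suc i)))
    (trans (cong toℕ (point-injective {r} eq)) (Fin.toℕ-cast (1+[2^r∸1]≡2^r r) (suc j)))))

-- The position dropped by `point′` is the first one, which is `index 𝟎`; any other index is a
-- successor and hence in the range of `point′`.
point′-surjective : ∀ {r} (a : F r) → a ≡ 𝟎 ⊎ (∃ λ i → point′ i ≡ a)
point′-surjective {r} a with cast (sym (1+[2^r∸1]≡2^r r)) (index a) in eq
... | zero  = inj₁ (trans (sym (point-index a))
  (trans (cong (point {r}) index-a≡index-𝟎) (point-index 𝟎)))
  where
  index-a≡index-𝟎 : index a ≡ index (𝟎 {r})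
  index-a≡index-𝟎 = Fin.toℕ-injective (trans
    (trans (sym (Fin.toℕ-cast (sym (1+[2^r∸1]≡2^r r)) (index a))) (cong toℕ eq))
    (sym (toℕ-index-𝟎 r)))
... | suc i = inj₂ (i , trans (cong (point {r}) cast-suc-i≡index-a) (point-index a))
  where
  cast-suc-i≡index-a : cast (1+[2^r∸1]≡2^r r) (suc i) ≡ index a
  cast-suc-i≡index-a = trans (cong (cast (1+[2^r∸1]≡2^r r)) (sym eq))
    (Fin.cast-involutive (1+[2^r∸1]≡2^r r) (sym (1+[2^r∸1]≡2^r r)) (index a))

module _ {n r : ℕ} (g : Fin n → F r) (g-injective : Injective _≡_ _≡_ g) where

  -- The case a ≡ 𝟎 needs no position indexed by 𝟎, as its term would vanish.
  syndrome-fibre : ∀ a → a ≡ 𝟎 ⊎ (∃ λ i → g i ≡ a) →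
    syndrome g (tabulate λ i → does (g i ≟ a)) ≡ a
  syndrome-fibre a (inj₁ refl) = trans (⊕.sum-cong-≗ vanish) (⊕.sum-replicate-zero n)
    where
    vanish : ∀ i → (if lookup (tabulate λ i → does (g i ≟ 𝟎)) i then g i else 𝟎) ≡ 𝟎
    vanish i rewrite Vec.lookup∘tabulate (λ i → does (g i ≟ 𝟎)) i with g i ≟ 𝟎
    ... | yes gi≡𝟎 = gi≡𝟎
    ... | no _     = refl
  syndrome-fibre a (inj₂ (p , refl)) = trans
    (⊕.sum-cong-≗ λ i → cong (λ b → if b then g i else 𝟎) (trans
      (Vec.lookup∘tabulate _ i)
      (trans (does-≡ (g i ≟ g p) (map′ (cong g) g-injective (i Fin.≟ p))) (sym (lookup-⁅⁆ p i)))))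
    (syndrome-⁅⁆ g p)

true∷point : ∀ {r} → Fin (2 ^ r) → F (suc r)
true∷point j = true ∷ point j

syndrome-e : ∀ {r} (a : F r) → syndrome true∷point (e a) ≡ true ∷ a
syndrome-e {r} a = trans
  (⊕.sum-cong-≗ λ i → cong (λ b → if b then true∷point i else 𝟎) (trans
    (Vec.lookup∘tabulate _ i)
    -- Both tests decide equivalent propositions, so `e a` is the unit word at `index a`.
    (trans (does-≡ (point i ≟ a) (map′ to from (i Fin.≟ index a)))
           (sym (lookup-⁅⁆ (index a) i)))))
  (trans (syndrome-⁅⁆ true∷point (index a)) (cong (true ∷_) (point-index a)))
  where
  to : ∀ {i} → i ≡ index a → point i ≡ a
  to i≡ = trans (cong point i≡) (point-index a)

  from : ∀ {i} → point i ≡ a → i ≡ index a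
  from i≡ = point-injective (trans i≡ (sym (point-index a)))

-- The parities of the two unit words cancel and their points add up to `a`, while `h` contributes
-- nothing.
syndrome-𝓗[] : ∀ {r} (a : F r) {c} → c ∈ 𝓗[ a ] → syndrome true∷point c ≡ false ∷ a
syndrome-𝓗[] {r} a (h , (s≡𝟎 , even) , refl) = begin
  syndrome true∷point (h ⊕ e a ⊕ e {r} 𝟎)
    ≡⟨ trans (syndrome-⊕ true∷point (h ⊕ e a) (e {r} 𝟎))
         (cong (_⊕ syndrome true∷point (e {r} 𝟎)) (syndrome-⊕ true∷point h (e a))) ⟩
  syndrome true∷point h ⊕ syndrome true∷point (e a) ⊕ syndrome true∷point (e {r} 𝟎)
    ≡⟨ cong₂ _⊕_ (cong₂ _⊕_
         (trans (syndrome-true∷ point h) (cong₂ _∷_ (wt-even⇒sumᵇ h even) s≡𝟎))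
         (syndrome-e a)) (syndrome-e {r} 𝟎) ⟩
  false ∷ (𝟎 ⊕ a ⊕ 𝟎)
    ≡⟨ cong (false ∷_) (trans (⊕.identityʳ _) (⊕.identityˡ a)) ⟩
  false ∷ a ∎
  where open ≡-Reasoning

syndrome-point-𝓗[] : ∀ {r} (a : F r) {c} → c ∈ 𝓗[ a ] → syndrome point c ≡ a
syndrome-point-𝓗[] a {c} c∈𝓗 =
  Vec.∷-injectiveʳ (trans (sym (syndrome-true∷ point c)) (syndrome-𝓗[] a c∈𝓗))

inhabited-𝓗[] : ∀ {r} (a : F r) → ∃ λ c → c ∈ 𝓗[ a ]
inhabited-𝓗[] {r} a = _ , 𝟎 , (syndrome-𝟎 point , cong (_% 2) (wt-𝟎 (2 ^ r))) , refl

syndrome-𝓗′[] : ∀ {r} (a : F r) {c} → c ∈ 𝓗′[ a ] → syndrome point′ c ≡ a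
syndrome-𝓗′[] {r} a (h , s≡𝟎 , refl) = trans (syndrome-⊕ point′ (e′ a) h)
  (trans (cong₂ _⊕_ (syndrome-fibre point′ (point′-injective {r}) a (point′-surjective a)) s≡𝟎)
    (⊕.identityʳ a))

inhabited-𝓗′[] : ∀ {r} (a : F r) → ∃ λ c → c ∈ 𝓗′[ a ]
inhabited-𝓗′[] a = _ , 𝟎 , syndrome-𝟎 point′ , refl

-- Periods of codes

-- As `k ⊕ k` is `𝟎`, this one inclusion already says that translation by `k` maps `D` onto itself.
Period : ∀ {n} → Code n → F n → Set
Period D k = ∀ {w} → w ∈ D → w ⊕ k ∈ D

tabulate-⊕ : ∀ {n} (f g : Fin n → Bool) →
  tabulate (λ i → f i xor g i) ≡ tabulate f ⊕ tabulate g
tabulate-⊕ {zero}  f g = refl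
tabulate-⊕ {suc n} f g = cong ((f zero xor g zero) ∷_) (tabulate-⊕ (f ∘ suc) (g ∘ suc))

permute-⊕ : ∀ {m n} (π : Permutation m n) x y → permute π (x ⊕ y) ≡ permute π x ⊕ permute π y
permute-⊕ π x y = trans
  (Vec.tabulate-cong λ i → Vec.lookup-zipWith _xor_ (π ⟨$⟩ˡ i) x y)
  (tabulate-⊕ (λ i → lookup x (π ⟨$⟩ˡ i)) λ i → lookup y (π ⟨$⟩ˡ i))

permute-flip : ∀ {m n} (π : Permutation m n) x → permute (flip π) (permute π x) ≡ x
permute-flip π x = trans
  (Vec.tabulate-cong λ i → trans
    (Vec.lookup∘tabulate (λ j → lookup x (π ⟨$⟩ˡ j)) (π ⟨$⟩ʳ i)) (cong (lookup x) (inverseˡ π)))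
  (Vec.tabulate∘lookup x)

-- The translation vector `x` of the equivalence cancels, so only the permutation acts on the
-- period.
equivalent-period : ∀ {m n} {C : Code m} {D : Code n} (C≈D : Equivalent C D) {k} →
  Period D k → Period C (permute (flip (proj₁ (proj₂ C≈D))) k)
equivalent-period {C = C} (x , π , ⊆D , D⊆) {k} D+k {c} c∈C
  with c′ , c′∈C , eq ← D⊆ (D+k (⊆D (c , c∈C , refl))) = subst (_∈ C) c′≡ c′∈C
  where
  πc′≡ : permute π c′ ≡ permute π c ⊕ k
  πc′≡ = ⊕.∙-cancelˡ x _ _ (trans (sym eq) (⊕.assoc x _ k))

  c′≡ : c′ ≡ c ⊕ permute (flip π) k
  c′≡ = trans (sym (permute-flip π c′)) (trans (cong (permute (flip π)) πc′≡)
    (trans (permute-⊕ (flip π) (permute π c) k) (cong (_⊕ _) (permute-flip π c))))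

sumᵇ-lookup-⊕ : ∀ {n} (x y : F n) → sumᵇ (lookup (x ⊕ y)) ≡ sumᵇ (lookup x) xor sumᵇ (lookup y)
sumᵇ-lookup-⊕ x y = trans (xor.sum-cong-≗ λ i → Vec.lookup-zipWith _xor_ i x y)
  (xor.∑-distrib-+ (lookup x) (lookup y))

⊕-∷ʳ : ∀ {n} (x y : F n) a b → (x ∷ʳ a) ⊕ (y ∷ʳ b) ≡ (x ⊕ y) ∷ʳ (a xor b)
⊕-∷ʳ []      []      a b = refl
⊕-∷ʳ (_ ∷ x) (_ ∷ y) a b = cong (_ ∷_) (⊕-∷ʳ x y a b)

extend-period : ∀ {n} {D : Code n} {k} → Period D k → Period (extend D) (k ∷ʳ sumᵇ (lookup k))
extend-period {k = k} D+k (w , w∈D , refl) = w ⊕ k , D+k w∈D ,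
  trans (⊕-∷ʳ w k _ _) (cong ((w ⊕ k) ∷ʳ_) (sym (sumᵇ-lookup-⊕ w k)))

-- Periods of Mollard codes

p₁-⊕ : ∀ {t m} (x y : F (t * m)) → p₁ {t} {m} (x ⊕ y) ≡ p₁ {t} x ⊕ p₁ {t} y
p₁-⊕ {t} {m} x y = trans
  (Vec.tabulate-cong {n = t} λ i → trans
    (xor.sum-cong-≗ λ j → Vec.lookup-zipWith _xor_ (combine i j) x y)
    (xor.∑-distrib-+ (λ j → lookup x (combine i j)) λ j → lookup y (combine i j)))
  (tabulate-⊕ {t} (λ i → sumᵇ {m} λ j → lookup x (combine i j))
    λ i → sumᵇ λ j → lookup y (combine i j))

p₂-⊕ : ∀ {t m} (x y : F (t * m)) → p₂ {t} {m} (x ⊕ y) ≡ p₂ {t} x ⊕ p₂ {t} y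
p₂-⊕ {t} {m} x y = trans
  (Vec.tabulate-cong {n = m} λ j → trans
    (xor.sum-cong-≗ {t} λ i → Vec.lookup-zipWith _xor_ (combine {t} i j) x y)
    (xor.∑-distrib-+ (λ i → lookup x (combine {t} i j)) λ i → lookup y (combine {t} i j)))
  (tabulate-⊕ {m} (λ j → sumᵇ {t} λ i → lookup x (combine {t} i j))
    λ j → sumᵇ {t} λ i → lookup y (combine {t} i j))

lookup-⁅combine⁆ : ∀ {t m} (i i′ : Fin t) (j j′ : Fin m) →
  lookup ⁅ combine i j ⁆ (combine i′ j′) ≡ does (i′ Fin.≟ i ×-dec j′ Fin.≟ j)
lookup-⁅combine⁆ i i′ j j′ = trans (lookup-⁅⁆ (combine i j) (combine i′ j′))
  (does-≡ (combine i′ j′ Fin.≟ combine i j)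
    (map′ (λ { (refl , refl) → refl }) (Fin.combine-injective i′ j′ i j)
      (i′ Fin.≟ i ×-dec j′ Fin.≟ j)))

-- Row `i′` of the matrix unit vanishes unless `i′` is `i`; row `i` is the unit word at `j`, whose
-- parity is odd.
p₁-⁅⁆ : ∀ {t m} (i : Fin t) (j : Fin m) → p₁ {t} {m} ⁅ combine i j ⁆ ≡ ⁅ i ⁆
p₁-⁅⁆ {t} {m} i j = trans (Vec.tabulate-cong row) (Vec.tabulate∘lookup ⁅ i ⁆)
  where
  row : ∀ i′ → (sumᵇ λ j′ → lookup ⁅ combine i j ⁆ (combine i′ j′)) ≡ lookup ⁅ i ⁆ i′
  row i′ rewrite lookup-⁅⁆ i i′ | xor.sum-cong-≗ (λ j′ → lookup-⁅combine⁆ i i′ j j′)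
    with does (i′ Fin.≟ i)
  ... | true  = trans (xor.sum-cong-≗ λ j′ → sym (lookup-⁅⁆ j j′)) (sumᵇ-⁅⁆ j)
  ... | false = xor.sum-replicate-zero m

p₂-⁅⁆ : ∀ {t m} (i : Fin t) (j : Fin m) → p₂ {t} {m} ⁅ combine {t} i j ⁆ ≡ ⁅ j ⁆
p₂-⁅⁆ {t} {m} i j = trans (Vec.tabulate-cong col) (Vec.tabulate∘lookup ⁅ j ⁆)
  where
  col : ∀ j′ → (sumᵇ λ i′ → lookup ⁅ combine {t} i j ⁆ (combine {t} i′ j′)) ≡ lookup ⁅ j ⁆ j′
  -- The conjunction is commuted so that the case split on `j′ Fin.≟ j` lets it compute.
  col j′
    rewrite lookup-⁅⁆ j j′
          | xor.sum-cong-≗ {t} (λ i′ →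
              trans (lookup-⁅combine⁆ {t} i i′ j j′) (Bool.∧-comm (does (i′ Fin.≟ i)) _))
    with does (j′ Fin.≟ j)
  ... | true  = trans (xor.sum-cong-≗ λ i′ → sym (lookup-⁅⁆ i i′)) (sumᵇ-⁅⁆ i)
  ... | false = xor.sum-replicate-zero t

inhabitant : ∀ n → {{NonZero n}} → Fin n
inhabitant (suc n) = zero

↑ˡ≢↑ʳ : ∀ {m n} (i : Fin m) (j : Fin n) → i ↑ˡ n ≢ m ↑ʳ j
↑ˡ≢↑ʳ {m} {n} i j eq
  with () ← trans (sym (Fin.splitAt-↑ˡ m i n)) (trans (cong (splitAt m) eq) (Fin.splitAt-↑ʳ m n j))

module _ {t m : ℕ} where

  triangle : Fin t → Fin m → List (Fin (t * m + (t + m)))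
  triangle i j =
    (combine i j ↑ˡ (t + m)) ∷ ((t * m) ↑ʳ (i ↑ˡ m)) ∷ ((t * m) ↑ʳ (t ↑ʳ j)) ∷ []

  triangleWord : Fin t → Fin m → F (t * m + (t + m))
  triangleWord i j = ⁅ combine i j ⁆ ++ ⁅ i ⁆ ++ ⁅ j ⁆

  triangle-unique : ∀ i j → Unique (triangle i j)
  triangle-unique i j =
    (↑ˡ≢↑ʳ _ _ ∷ ↑ˡ≢↑ʳ _ _ ∷ []) ∷
    ((↑ˡ≢↑ʳ i j ∘ Fin.↑ʳ-injective (t * m) _ _) ∷ []) ∷ [] ∷ []

  -- A position of the first block is a pair `(i, j)`. One of the other blocks fixes only `i` or
  -- only `j`, and the missing index exists because `t` and `m` are positive.
  triangles-cover : {{NonZero t}} → {{NonZero m}} → {P : Pred (Fin (t * m + (t + m))) 0ℓ} →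
    (∀ i j → All P (triangle i j)) → ∀ q → P q
  triangles-cover {P = P} P-triangle q with splitAt (t * m) q in eq
  ... | inj₁ ij with i , j , refl ← Fin.combine-surjective {t} ij =
    subst P (Fin.splitAt⁻¹-↑ˡ eq) (All.lookup (P-triangle i j) (here refl))
  ... | inj₂ p with splitAt t p in eq′
  ...   | inj₁ i = subst P
    (trans (cong ((t * m) ↑ʳ_) (Fin.splitAt⁻¹-↑ˡ eq′)) (Fin.splitAt⁻¹-↑ʳ eq))
    (All.lookup (P-triangle i (inhabitant m)) (there (here refl)))
  ...   | inj₂ j = subst P
    (trans (cong ((t * m) ↑ʳ_) (Fin.splitAt⁻¹-↑ʳ eq′)) (Fin.splitAt⁻¹-↑ʳ eq))
    (All.lookup (P-triangle (inhabitant t) j) (there (there (here refl))))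

  syndrome-triangle : ∀ {d} (σ : Fin (t * m + (t + m)) → F d) i j →
    syndrome σ (triangleWord i j) ≡ foldr (λ p → σ p ⊕_) 𝟎 (triangle i j)
  syndrome-triangle σ i j = trans (syndrome-++ σ ⁅ combine i j ⁆ (⁅ i ⁆ ++ ⁅ j ⁆))
    (cong₂ _⊕_ (syndrome-⁅⁆ _ (combine i j))
      (trans (syndrome-++ (σ ∘ ((t * m) ↑ʳ_)) ⁅ i ⁆ ⁅ j ⁆)
        (cong₂ _⊕_ (syndrome-⁅⁆ _ i) (trans (syndrome-⁅⁆ _ j) (sym (⊕.identityʳ _))))))

  -- Three ones are odd in number; the parity is read off as the syndrome with all labels
  -- `true ∷ []`. Hence the extended word also contains the parity coordinate.
  sumᵇ-triangle : ∀ i j → sumᵇ (lookup (triangleWord i j)) ≡ true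
  sumᵇ-triangle i j = cong head (trans (sym (syndrome-true∷ (const []) (triangleWord i j)))
    (syndrome-triangle (const (true ∷ [])) i j))

module _ (M : Mollard) where
  open Mollard M

  -- The word is the element of the linear code Z generated by the matrix unit `x′`, so it is
  -- absorbed into `x` while `y` and `z` stay the same.
  triangle-period : ∀ i j → Period code (triangleWord {t} {m} i j)
  triangle-period i j (x , y , z , y∈C , z∈D , refl) =
    x ⊕ x′ , y , z , y∈C , z∈D , trans (⊕.assoc v _ _) (cong (v ⊕_) (begin
      (x ++ p₁ x ++ p₂ {t} x) ⊕ triangleWord {t} i j
        ≡⟨ cong (_ ⊕_) (cong (x′ ++_) (cong₂ _++_ (p₁-⁅⁆ i j) (p₂-⁅⁆ i j))) ⟨
      (x ++ p₁ x ++ p₂ {t} x) ⊕ (x′ ++ p₁ x′ ++ p₂ {t} x′)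
        ≡⟨ Vec.zipWith-++ _xor_ x _ x′ _ ⟩
      (x ⊕ x′) ++ ((p₁ x ++ p₂ {t} x) ⊕ (p₁ x′ ++ p₂ {t} x′))
        ≡⟨ cong ((x ⊕ x′) ++_) (Vec.zipWith-++ _xor_ (p₁ {t} x) _ (p₁ {t} x′) _) ⟩
      (x ⊕ x′) ++ (p₁ x ⊕ p₁ x′) ++ (p₂ {t} x ⊕ p₂ {t} x′)
        ≡⟨ cong ((x ⊕ x′) ++_) (cong₂ _++_ (p₁-⊕ {t} x x′) (p₂-⊕ {t} x x′)) ⟨
      (x ⊕ x′) ++ p₁ (x ⊕ x′) ++ p₂ {t} (x ⊕ x′) ∎))
    where
    open ≡-Reasoning
    x′ = ⁅ combine i j ⁆
    v = 𝟎 {t * m} ++ y ++ (z ⊕ f y y∈C)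

-- Labelled positions and the periods of S and S′

module _ {r : ℕ} where

  -- Right-half positions are labelled by their point, left-half ones by nothing.
  Label : Set
  Label = Maybe (F r)

  -- Left-half positions count for nothing; a right-half position carries its point and a bit that
  -- counts it modulo two.
  encode : Label → F (suc r)
  encode nothing  = 𝟎
  encode (just v) = true ∷ v

  total : List Label → F (suc r)
  total = foldr (λ l → encode l ⊕_) 𝟎

  -- Two labels `nothing` are apart too: distinct positions of the left half share this label, and
  -- only equal points are excluded.
  Apart : Label → Label → Set
  Apart l l′ = ∀ v → l ≡ just v → l′ ≢ just v

  -- Without the left-half labels, every sum with exactly two right-half labels takes the one form
  -- that `apart-pair` treats.
  total-catMaybes : ∀ ls → total ls ≡ total (map just (catMaybes ls))
  total-catMaybes []             = refl
  total-catMaybes (just v ∷ ls)  = cong (encode (just v) ⊕_) (total-catMaybes ls)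
  total-catMaybes (nothing ∷ ls) = trans (⊕.identityˡ _) (total-catMaybes ls)

  -- Over GF(2) two points with sum `𝟎` are equal.
  apart-pair : ∀ {u v} → total (just u ∷ just v ∷ []) ≡ 𝟎 → Apart (just u) (just v) → ∀ {A : Set} → A
  apart-pair {u} {v} eq u#v = ⊥-elim (u#v u refl (cong just (sym
    (⊕.x∙y⁻¹≈ε⇒x≈y u v (trans (cong (u ⊕_) (sym (⊕.identityʳ v))) (Vec.∷-injectiveʳ eq))))))

  SameKind : Label → Label → Set
  SameKind l l′ = is-just l′ ≡ is-just l

  -- The head bit of the total makes the number of right-half labels even, and exactly two would
  -- carry equal points; so there are none or four.
  sameKind : ∀ {w x y z} → AllPairs Apart (w ∷ x ∷ y ∷ z ∷ []) →
    total (w ∷ x ∷ y ∷ z ∷ []) ≡ 𝟎 → All (SameKind w) (x ∷ y ∷ z ∷ [])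
  sameKind {w} {x} {y} {z} ((wx ∷ wy ∷ wz ∷ []) ∷ (xy ∷ xz ∷ []) ∷ (yz ∷ []) ∷ _) eq =
    go w x y z wx wy wz xy xz yz (trans (sym (total-catMaybes (w ∷ x ∷ y ∷ z ∷ []))) eq)
    where
    go : ∀ w x y z → Apart w x → Apart w y → Apart w z → Apart x y → Apart x z → Apart y z →
      total (map just (catMaybes (w ∷ x ∷ y ∷ z ∷ []))) ≡ 𝟎 → All (SameKind w) (x ∷ y ∷ z ∷ [])
    -- An odd number of right-half labels leaves no case: the total would have head `true`, against
    -- the head `false` of `𝟎`.
    go nothing  nothing  nothing  nothing  _  _  _  _  _  _  _  = refl ∷ refl ∷ refl ∷ []
    go (just _) (just _) (just _) (just _) _  _  _  _  _  _  _  = refl ∷ refl ∷ refl ∷ []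
    go (just _) (just _) nothing  nothing  wx _  _  _  _  _  eq = apart-pair eq wx
    go (just _) nothing  (just _) nothing  _  wy _  _  _  _  eq = apart-pair eq wy
    go (just _) nothing  nothing  (just _) _  _  wz _  _  _  eq = apart-pair eq wz
    go nothing  (just _) (just _) nothing  _  _  _  xy _  _  eq = apart-pair eq xy
    go nothing  (just _) nothing  (just _) _  _  _  _  xz _  eq = apart-pair eq xz
    go nothing  nothing  (just _) (just _) _  _  _  _  _  yz eq = apart-pair eq yz

  label : ∀ n → Fin (n + 2 ^ r) → Label
  label n p = [ const nothing , just ∘ point ]′ (splitAt n p)

  label-↑ˡ : ∀ {n} (i : Fin n) → label n (i ↑ˡ (2 ^ r)) ≡ nothing
  label-↑ˡ {n} i = cong [ const nothing , just ∘ point ]′ (Fin.splitAt-↑ˡ n i (2 ^ r))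

  label-↑ʳ : ∀ n j → label n (n ↑ʳ j) ≡ just (point j)
  label-↑ʳ n j = cong [ const nothing , just ∘ point ]′ (Fin.splitAt-↑ʳ n (2 ^ r) j)

  label-apart : ∀ n {p q} → p ≢ q → Apart (label n p) (label n q)
  label-apart n {p} {q} p≢q v lp lq with splitAt n p in eqp | splitAt n q in eqq
  ... | inj₂ j | inj₂ j′ = p≢q (trans (sym (Fin.splitAt⁻¹-↑ʳ eqp)) (trans
    (cong (n ↑ʳ_) (point-injective {r} (just-injective (trans lp (sym lq))))) (Fin.splitAt⁻¹-↑ʳ eqq)))

  permuted-apart : ∀ n {N} (π : Permutation (n + 2 ^ r) N) {ps} → Unique ps →
    AllPairs Apart (map (label n ∘ (π ⟨$⟩ˡ_)) ps)
  permuted-apart n π = AllPairs.map⁺ ∘ AllPairs.map λ p≢q → label-apart n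
    λ eq → p≢q (trans (sym (inverseʳ π)) (trans (cong (π ⟨$⟩ʳ_) eq) (inverseʳ π)))

  Additive : (F r → F r) → F r → Set
  Additive τ s = ∀ a → τ (a ⊕ s) ≡ τ a ⊕ τ s

  module _ {τ : F r → F r} (τ𝟎≡𝟎 : τ 𝟎 ≡ 𝟎) (rigid : ∀ s → Additive τ s → s ≡ 𝟎)
    {n : ℕ} {A : F r → Code n} (g : Fin n → F r)
    (syndrome-A : ∀ a {c} → c ∈ A a → syndrome g c ≡ a)
    (inhabited-A : ∀ a → ∃ λ c → c ∈ A a) where

    -- For `𝓗[_]` with labels `point` this is `S τ`, and for `𝓗′[_]` with labels `point′` it is
    -- `S′ τ`.
    U : Code (n + 2 ^ r)
    U = ⋃[ a ∶ F r ] (A a ×ᶜ 𝓗[ τ a ])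

    left : Fin (n + 2 ^ r) → F r
    left p = [ g , const 𝟎 ]′ (splitAt n p)

    right : Fin (n + 2 ^ r) → F (suc r)
    right p = encode (label n p)

    -- Each labelling vanishes on the opposite half and so sees one factor only. Thus the index `a`
    -- in the union is a linear function of the codeword.
    syndromes : ∀ {w} (w∈U : w ∈ U) →
      syndrome left w ≡ proj₁ w∈U × syndrome right w ≡ false ∷ τ (proj₁ w∈U)
    syndromes (a , x , y , x∈A , y∈𝓗 , refl) =
      trans (syndrome-++ left x y) (trans (cong₂ _⊕_
        (trans (syndrome-cong (λ i → cong [ g , const 𝟎 ]′ (Fin.splitAt-↑ˡ n i _)) x)
          (syndrome-A a x∈A))
        (trans (syndrome-cong (λ j → cong [ g , const 𝟎 ]′ (Fin.splitAt-↑ʳ n _ j)) y)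
          (syndrome-const𝟎 y)))
        (⊕.identityʳ a)) ,
      trans (syndrome-++ right x y) (trans (cong₂ _⊕_
        (trans (syndrome-cong (λ i → cong encode (label-↑ˡ i)) x) (syndrome-const𝟎 x))
        (trans (syndrome-cong (λ j → cong encode (label-↑ʳ n j)) y) (syndrome-𝓗[] (τ a) y∈𝓗)))
        (⊕.identityˡ _))

    period-syndrome : ∀ {k} → Period U k → syndrome right k ≡ 𝟎
    period-syndrome {k} U+k = trans right-k
      (cong (false ∷_) (trans (cong τ (rigid s additive)) τ𝟎≡𝟎))
      where
      s = syndrome left k

      -- Adding `k` to a codeword of index `a` gives one of index `a ⊕ s`, whose right syndrome is
      -- therefore prescribed by `τ`.
      shifted : ∀ a → (false ∷ τ a) ⊕ syndrome right k ≡ false ∷ τ (a ⊕ s)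
      shifted a = trans (cong (_⊕ syndrome right k) (sym (proj₂ (syndromes w∈U))))
        (trans (sym (syndrome-⊕ right w k)) (trans (proj₂ (syndromes (U+k w∈U)))
          (cong (λ v → false ∷ τ v) (trans (sym (proj₁ (syndromes (U+k w∈U))))
            (trans (syndrome-⊕ left w k) (cong (_⊕ s) (proj₁ (syndromes w∈U))))))))
        where
        w = proj₁ (inhabited-A a) ++ proj₁ (inhabited-𝓗[] (τ a))

        w∈U : w ∈ U
        w∈U = a , _ , _ , proj₂ (inhabited-A a) , proj₂ (inhabited-𝓗[] (τ a)) , refl

      -- The instance `a = 𝟎` determines the right syndrome of `k`; put back into `shifted`, it
      -- yields additivity at `s`.
      right-k : syndrome right k ≡ false ∷ τ s
      right-k = trans (sym (⊕.identityˡ _)) (trans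
        (cong (λ v → (false ∷ v) ⊕ syndrome right k) (sym τ𝟎≡𝟎))
        (trans (shifted 𝟎) (cong (λ v → false ∷ τ v) (⊕.identityˡ s))))

      additive : Additive τ s
      additive a = sym (Vec.∷-injectiveʳ (trans (cong ((false ∷ τ a) ⊕_) (sym right-k)) (shifted a)))

    -- Moving the permutation from the word to the labels keeps `k` in its explicit form as a period
    -- of `D`.
    equivalent-syndrome : ∀ {N} {D : Code N} (U≈D : Equivalent U D) {k} → Period D k →
      syndrome (encode ∘ label n ∘ (proj₁ (proj₂ U≈D) ⟨$⟩ˡ_)) k ≡ 𝟎
    equivalent-syndrome U≈D@(_ , π , _) {k} D+k = trans
      (sym (syndrome-permute right (flip π) k)) (period-syndrome (equivalent-period U≈D D+k))

-- Full deficiency and rigidity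

count≡0⇒∉ : ∀ {A : Set} {P : Pred A 0ℓ} (P? : Decidable P) {n} (xs : Vec A n) →
  count P? xs ≡ 0 → ∀ i → ¬ P (lookup xs i)
count≡0⇒∉ P? (x ∷ xs) eq i px with P? x
count≡0⇒∉ P? (x ∷ xs) eq zero    px | no ¬px = ¬px px
count≡0⇒∉ P? (x ∷ xs) eq (suc i) px | no ¬px = count≡0⇒∉ P? xs eq i px

-- One preserved star would make the argument of the logarithm at least two, and subtracting a
-- positive number from a positive `r` makes it smaller.
deficiency≡r⇒preservedStars≡0 : ∀ {r} (τ : F r → F r) → 1 ≤ r → deficiency τ ≡ r →
  preservedStars τ ≡ 0
deficiency≡r⇒preservedStars≡0 {suc r} τ 1≤r deficient with preservedStars τ
... | zero  = refl
-- Abstracting the bound along with the logarithm excludes the value zero.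
... | suc p with ⌊log₂ suc p + 1 ⌋ | 1≤log
  where
  1≤log : 1 ≤ ⌊log₂ suc p + 1 ⌋
  1≤log = subst (_≤ ⌊log₂ suc p + 1 ⌋) (⌊log₂[2^n]⌋≡n 1) (⌊log₂⌋-mono-≤ (s≤s (ℕ.m≤n+m 1 p)))
...   | suc l | _ = contradiction (sym deficient) (ℕ.1+m≢m∸n l)

module _ {r : ℕ} (τ : F r → F r) (τ-bijective : Bijective _≡_ _≡_ τ) (τ𝟎≡𝟎 : τ 𝟎 ≡ 𝟎) where

  private
    τ-injective  = proj₁ τ-bijective
    τ-surjective = proj₂ τ-bijective

  -- Additivity sends the triple of `s` and `b` to that of `τ s` and `τ b`. Injectivity keeps the
  -- image nondegenerate, and surjectivity reaches every triple through `τ s`.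
  additive⇒preservesStar : ∀ s → Additive τ s → PreservesStar τ s
  additive⇒preservesStar s additive = to , from
    where
    τ[s⊕] : ∀ b → τ (s ⊕ b) ≡ τ s ⊕ τ b
    τ[s⊕] b = trans (cong τ (⊕.comm s b)) (trans (additive b) (⊕.comm (τ b) (τ s)))

    to : ∀ {T} → T ∈ τ[Star s ] τ → T ∈ Star (τ s)
    to (b , b≢𝟎 , b≢s , refl) = τ b
      , (λ τb≡𝟎 → b≢𝟎 (τ-injective (trans τb≡𝟎 (sym τ𝟎≡𝟎))))
      , (λ τb≡τs → b≢s (τ-injective τb≡τs))
      , cong (triple (τ s) (τ b)) (τ[s⊕] b)

    from : ∀ {T} → T ∈ Star (τ s) → T ∈ τ[Star s ] τ
    from (b′ , b′≢𝟎 , b′≢τs , refl)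
      with b , τb≡b′ ← τ-surjective b′
      with refl ← τb≡b′ refl = b
      , (λ { refl → b′≢𝟎 τ𝟎≡𝟎 })
      , (λ { refl → b′≢τs refl })
      , cong (triple (τ s) (τ b)) (sym (τ[s⊕] b))

  -- A nonzero `s` of this kind would be counted among the preserved stars, of which there are none.
  deficiency≡r⇒rigid : 1 ≤ r → deficiency τ ≡ r → ∀ s → Additive τ s → s ≡ 𝟎
  deficiency≡r⇒rigid 1≤r deficient s additive with s ≟ 𝟎
  ... | yes s≡𝟎 = s≡𝟎
  ... | no  s≢𝟎 = ⊥-elim (count≡0⇒∉ (λ a → ¬? (a ≟ 𝟎) ×-dec PreservesStar? τ a)
    (tabulate (point {r})) (deficiency≡r⇒preservedStars≡0 τ 1≤r deficient) (index s)
    (subst (λ a → a ≢ 𝟎 × PreservesStar τ a)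
      (sym (trans (Vec.lookup∘tabulate point (index s)) (point-index s)))
      (s≢𝟎 , additive⇒preservesStar s additive)))

-- The two non-equivalences

module _ {r : ℕ} {τ : F r → F r} (τ𝟎≡𝟎 : τ 𝟎 ≡ 𝟎) (rigid : ∀ s → Additive τ s → s ≡ 𝟎)
  (M : Mollard) where

  open Mollard M

  private
    length : ℕ
    length = t * m + (t + m)

    j₀ : Fin (2 ^ r)
    j₀ = index (𝟎 {r})

  S≁extendedMollard : ¬ Equivalent (S τ) (extend code)
  -- The position `j₀` of either half must have the kind of `parity`, but one is labelled and the
  -- other is not.
  S≁extendedMollard S≈ext@(_ , π , _) = contradiction
    (trans (same-kind {2 ^ r ↑ʳ j₀} (label-↑ʳ {r} (2 ^ r) j₀))
      (sym (same-kind {j₀ ↑ˡ 2 ^ r} (label-↑ˡ {r} j₀))))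
    λ ()
    where
    ℓ : Fin (suc length) → Label {r}
    ℓ q = label {r} (2 ^ r) (π ⟨$⟩ˡ q)

    parity : Fin (suc length)
    parity = fromℕ length

    total≡𝟎 : ∀ i j → total (map ℓ (parity ∷ map inject₁ (triangle {t} {m} i j))) ≡ 𝟎
    total≡𝟎 i j = begin
      total (map ℓ (parity ∷ map inject₁ (triangle {t} {m} i j)))
        ≡⟨ ⊕.comm (encode (ℓ parity)) _ ⟩
      total (map (ℓ ∘ inject₁) (triangle {t} {m} i j)) ⊕ encode (ℓ parity)
        -- The parity of a triangle is `true`, so the parity position enters the sum as a fourth
        -- term.
        ≡⟨ cong₂ _⊕_ (syndrome-triangle {t} {m} _ i j)
             (cong (λ b → if b then encode (ℓ parity) else 𝟎) (sumᵇ-triangle {t} {m} i j)) ⟨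
      syndrome (encode ∘ ℓ ∘ inject₁) k ⊕ (if sumᵇ (lookup k) then encode (ℓ parity) else 𝟎)
        ≡⟨ syndrome-∷ʳ (encode ∘ ℓ) k _ ⟨
      syndrome (encode ∘ ℓ) (k ∷ʳ sumᵇ (lookup k))
        ≡⟨ equivalent-syndrome τ𝟎≡𝟎 rigid point syndrome-point-𝓗[] inhabited-𝓗[]
             S≈ext (extend-period (triangle-period M i j)) ⟩
      𝟎 ∎
      where
      open ≡-Reasoning
      k = triangleWord {t} {m} i j

    parity-fresh : ∀ qs → All (parity ≢_) (map inject₁ qs)
    parity-fresh qs = All.map⁺ (All.universal (λ _ → Fin.fromℕ≢inject₁) qs)

    triangle-kind : ∀ i j → All (SameKind (ℓ parity) ∘ ℓ ∘ inject₁) (triangle {t} {m} i j)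
    triangle-kind i j = All.map⁻ {f = inject₁} (All.map⁻ {f = ℓ} (sameKind
      (permuted-apart (2 ^ r) π
        (parity-fresh _ ∷ Unique.map⁺ Fin.inject₁-injective (triangle-unique {t} {m} i j)))
      (total≡𝟎 i j)))

    all-kind : ∀ q → SameKind (ℓ parity) (ℓ q)
    all-kind q with view q
    ... | ‵fromℕ          = refl
    ... | ‵inj₁ {i = q} _ = triangles-cover {t} {m} triangle-kind q

    same-kind : ∀ {p} {l : Label {r}} → label {r} (2 ^ r) p ≡ l → is-just l ≡ is-just (ℓ parity)
    same-kind {p} refl =
      trans (cong (is-just ∘ label {r} (2 ^ r)) (sym (inverseˡ π))) (all-kind (π ⟨$⟩ʳ p))

  -- An unlabelled dummy position plays the part of the missing parity check.
  S′≁Mollard : ¬ Equivalent (S′ τ) code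
  S′≁Mollard S′≈M@(_ , π , _) = contradiction
    -- Every position has the kind of the dummy, hence lies in the left half, whereas the right half
    -- contains `j₀`.
    (trans (sym (cong is-just (label-↑ʳ {r} (2 ^ r ∸ 1) j₀)))
      (trans (cong (is-just ∘ label {r} (2 ^ r ∸ 1)) (sym (inverseˡ π)))
        (triangles-cover {t} {m} triangle-kind (π ⟨$⟩ʳ ((2 ^ r ∸ 1) ↑ʳ j₀)))))
    λ ()
    where
    ℓ : Fin length → Label {r}
    ℓ q = label {r} (2 ^ r ∸ 1) (π ⟨$⟩ˡ q)

    total≡𝟎 : ∀ i j → total (map ℓ (triangle {t} {m} i j)) ≡ 𝟎
    total≡𝟎 i j = trans (sym (syndrome-triangle {t} {m} (encode ∘ ℓ) i j))
      (equivalent-syndrome τ𝟎≡𝟎 rigid point′ syndrome-𝓗′[] inhabited-𝓗′[]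
        S′≈M (triangle-period M i j))

    triangle-kind : ∀ i j → All (SameKind nothing ∘ ℓ) (triangle {t} {m} i j)
    triangle-kind i j = All.map⁻ {f = ℓ} (sameKind {w = nothing}
      -- The dummy label `nothing` carries no point and is thus apart from every label.
      (All.universal (λ _ _ ()) _ ∷ permuted-apart (2 ^ r ∸ 1) π (triangle-unique {t} {m} i j))
      (trans (⊕.identityˡ _) (total≡𝟎 i j)))

theorem2 : (r : ℕ) → 1 ≤ r → (τ : F r → F r) → Bijective _≡_ _≡_ τ → τ 𝟎 ≡ 𝟎 →
    deficiency τ ≡ r →
    ((M : Mollard) → ¬ Equivalent (S τ) (extend (Mollard.code M))) ×
    ((M : Mollard) → ¬ Equivalent (S′ τ) (Mollard.code M))
theorem2 r 1≤r τ τ-bijective τ𝟎≡𝟎 deficient =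
  S≁extendedMollard τ𝟎≡𝟎 rigid , S′≁Mollard τ𝟎≡𝟎 rigid
  where
  rigid : ∀ s → Additive τ s → s ≡ 𝟎
  rigid = deficiency≡r⇒rigid τ τ-bijective τ𝟎≡𝟎 1≤r deficient
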